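{- If $G$ is a bipartite graph, then $\ker(G)=\mathrm{core}(G)$.
   Context: All graphs are finite, undirected, without loops or multiple edges. A bipartite graph is written $G=(A,B,E)$ with bipartition $\{A,B\}$, where $A\neq\emptyset\neq B$. Let $V$ be the vertex set of $G$. For $X\subseteq V$, $N(X)=\{v\in V: v \text{ has a neighbor in } X\}$ and $d(X)=|X|-|N(X)|$, with $d(\emptyset)=0$. A set of vertices is independent if no two of its vertices are adjacent. Let $id_c(G)=\max\{d(I): I\subseteq V \text{ independent}\}$ (this is known to equal $d_c(G)=\max\{d(X):X\subseteq V\}$). A critical independent set is an independent set $S$ with $d(S)=id_c(G)$. $\ker(G)$ is the intersection of all critical independent sets of $G$. $\mathrm{core}(G)$ is the intersection of all maximum-size independent sets of $G$. -}

module Defs where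

open import Data.Fin using (Fin)
open import Data.Fin.Properties using (any?; all?)
open import Data.Fin.Subset
  using (Subset; inside; outside; ⊥; ⊤; _∈_; _∩_; _∪_; ∣_∣; Nonempty)
open import Data.Fin.Subset.Properties using (_∈?_)
open import Data.Integer using (ℤ; +_; _-_)
open import Data.Integer.Properties using (≤-totalOrder)
open import Data.List using (List; []; _∷_; _++_; map; filter)
open import Data.List.Extrema ≤-totalOrder using (max)
open import Data.Nat using (ℕ; zero; suc; _≤_)
open import Data.Product using (_×_; ∃₂)
open import Data.Vec using (tabulate; []; _∷_)
open import Level using (0ℓ)
open import Relation.Binary
  using (Rel; Decidable; Symmetric; Irreflexive)
open import Relation.Binary.PropositionalEquality using (_≡_)
open import Relation.Nullary using (¬_; Dec; does)
open import Relation.Nullary.Decidable using (_×-dec_; _→-dec_; ¬?)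
open import Relation.Unary using (Pred)

-- Finite simple graphs, with vertex set Fin n.  Adjacency is decidable
-- because an edge set is a finite set of pairs; this is what lets
-- neighbourhoods be elements of Subset n and hence have a cardinality.
record Graph (n : ℕ) : Set₁ where
  infix 4 _~_ _~?_
  field
    _~_      : Rel (Fin n) 0ℓ
    _~?_     : Decidable _~_
    ~-sym    : Symmetric _~_
    ~-irrefl : Irreflexive _≡_ _~_

subsets : ∀ n → List (Subset n)
subsets zero    = [] ∷ []
subsets (suc n) = map (outside ∷_) (subsets n) ++ map (inside ∷_) (subsets n)

module _ {n : ℕ} (G : Graph n) where
  open Graph G

  Independent : Subset n → Set
  Independent X = ∀ u v → u ∈ X → v ∈ X → ¬ (u ~ v)

  independent? : ∀ X → Dec (Independent X)
  independent? X =
    all? λ u → all? λ v → (u ∈? X) →-dec ((v ∈? X) →-dec ¬? (u ~? v))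

  record IsBipartition (A B : Subset n) : Set where
    field
      A-nonempty    : Nonempty A
      B-nonempty    : Nonempty B
      disjoint      : A ∩ B ≡ ⊥
      covering      : A ∪ B ≡ ⊤
      A-independent : Independent A
      B-independent : Independent B

  Bipartite : Set
  Bipartite = ∃₂ IsBipartition

  -- The open neighbourhood: it may meet X, when X is not independent.
  N : Subset n → Subset n
  N X = tabulate λ v → does (any? λ u → (u ∈? X) ×-dec (v ~? u))

  d : Subset n → ℤ
  d X = + ∣ X ∣ - + ∣ N X ∣

  -- The first argument of max is a default that takes part in the maximum;
  -- d ⊥ is already one of the values, as the empty set is independent.
  id-c : ℤ
  id-c = max (d ⊥) (map d (filter independent? (subsets n)))

  CriticalIndependent : Subset n → Set
  CriticalIndependent S = Independent S × d S ≡ id-c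

  MaximumIndependent : Subset n → Set
  MaximumIndependent S =
    Independent S × (∀ T → Independent T → ∣ T ∣ ≤ ∣ S ∣)

  ker : Pred (Fin n) 0ℓ
  ker v = ∀ S → CriticalIndependent S → v ∈ S

  core : Pred (Fin n) 0ℓ
  core v = ∀ S → MaximumIndependent S → v ∈ S

{-# OPTIONS --safe #-}

-- The key inequality is the uncrossing  d X + d Y ≤ d (X ─ N Y) + d (Y ─ N X).
--
-- ker ⊆ core: if S is critical and M is a maximum independent set, then
-- S ∪ (M ─ N S) is independent, hence no larger than M; this forces
-- d S ≤ d (S ∩ M), so S ∩ M is critical and contains ker.
--
-- core ⊆ ker: if S is critical, uncrossing an arbitrary X ⊆ A with S ∩ B
-- shows that S ∩ A maximises d among all subsets of A.  Since an independent
-- set T has at most ∣ B ∣ + d (T ∩ A) elements, (S ∩ A) ∪ (B ─ N (S ∩ A)) is a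
-- maximum independent set, and its trace on A is S ∩ A.
module Submission where

open import Defs
open import Data.Fin.Properties using (any?)
open import Data.Fin.Subset
  using (Subset; inside; outside; ⊥; _∈_; _∉_; _⊆_; _∩_; _∪_; _─_; ∣_∣)
open import Data.Fin.Subset.Properties
import Data.Integer as ℤ
import Data.Integer.Properties as ℤ
import Data.Integer.Tactic.RingSolver as ℤ
open import Data.List using (map; filter)
open import Data.List.Extrema ℤ.≤-totalOrder using (xs≤max; argmax-sel)
import Data.List.Membership.Propositional as List
open import Data.List.Membership.Propositional.Properties
  using (∈-map⁺; ∈-map⁻; ∈-++⁺ˡ; ∈-++⁺ʳ; ∈-filter⁺; ∈-filter⁻)
import Data.List.Relation.Unary.All as All
open import Data.List.Relation.Unary.Any using (here)
open import Data.Nat using (ℕ; suc; _+_; _≤_)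
open import Data.Nat.Properties
open import Data.Nat.Tactic.RingSolver using (solve-∀)
open import Data.Product using (∃; _×_; _,_; proj₁; proj₂)
open import Data.Sum using (_⊎_; inj₁; inj₂)
open import Data.Vec using ([]; _∷_; there)
open import Data.Vec.Properties using ([]=⇒lookup; lookup⇒[]=; lookup∘tabulate)
open import Function using (id; _∘_)
open import Relation.Binary.PropositionalEquality
open import Relation.Nullary using (yes; does; contradiction)
open import Relation.Nullary.Decidable using (_×-dec_; dec-true)
open import Relation.Unary using (_≐_)

private variable
  n : ℕ

-- Sizes of finite subsets.

∣p∪q∣+∣p∩q∣≡∣p∣+∣q∣ : (p q : Subset n) → ∣ p ∪ q ∣ + ∣ p ∩ q ∣ ≡ ∣ p ∣ + ∣ q ∣
∣p∪q∣+∣p∩q∣≡∣p∣+∣q∣ []            []            = refl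
∣p∪q∣+∣p∩q∣≡∣p∣+∣q∣ (outside ∷ p) (outside ∷ q) = ∣p∪q∣+∣p∩q∣≡∣p∣+∣q∣ p q
∣p∪q∣+∣p∩q∣≡∣p∣+∣q∣ (inside  ∷ p) (outside ∷ q) = cong suc (∣p∪q∣+∣p∩q∣≡∣p∣+∣q∣ p q)
∣p∪q∣+∣p∩q∣≡∣p∣+∣q∣ (outside ∷ p) (inside  ∷ q) =
  trans (cong suc (∣p∪q∣+∣p∩q∣≡∣p∣+∣q∣ p q)) (sym (+-suc ∣ p ∣ ∣ q ∣))
∣p∪q∣+∣p∩q∣≡∣p∣+∣q∣ (inside  ∷ p) (inside  ∷ q) =
  cong suc (trans (+-suc ∣ p ∪ q ∣ ∣ p ∩ q ∣)
    (trans (cong suc (∣p∪q∣+∣p∩q∣≡∣p∣+∣q∣ p q)) (sym (+-suc ∣ p ∣ ∣ q ∣))))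

∣p─q∣+∣p∩q∣≡∣p∣ : (p q : Subset n) → ∣ p ─ q ∣ + ∣ p ∩ q ∣ ≡ ∣ p ∣
∣p─q∣+∣p∩q∣≡∣p∣ []            []            = refl
∣p─q∣+∣p∩q∣≡∣p∣ (outside ∷ p) (outside ∷ q) = ∣p─q∣+∣p∩q∣≡∣p∣ p q
∣p─q∣+∣p∩q∣≡∣p∣ (outside ∷ p) (inside  ∷ q) = ∣p─q∣+∣p∩q∣≡∣p∣ p q
∣p─q∣+∣p∩q∣≡∣p∣ (inside  ∷ p) (outside ∷ q) = cong suc (∣p─q∣+∣p∩q∣≡∣p∣ p q)
∣p─q∣+∣p∩q∣≡∣p∣ (inside  ∷ p) (inside  ∷ q) =
  trans (+-suc ∣ p ─ q ∣ ∣ p ∩ q ∣) (cong suc (∣p─q∣+∣p∩q∣≡∣p∣ p q))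

x∈p─q⇒x∉q : ∀ {x} (p q : Subset n) → x ∈ p ─ q → x ∉ q
x∈p─q⇒x∉q (_ ∷ p) (_ ∷ q) (there x∈p─q) (there x∈q) = x∈p─q⇒x∉q p q x∈p─q x∈q

Disjoint : Subset n → Subset n → Set
Disjoint p q = ∀ {x} → x ∈ p → x ∉ q

∣p∪q∣≤∣p∣+∣q∣ : (p q : Subset n) → ∣ p ∪ q ∣ ≤ ∣ p ∣ + ∣ q ∣
∣p∪q∣≤∣p∣+∣q∣ p q = m+n≤o⇒m≤o _ (≤-reflexive (∣p∪q∣+∣p∩q∣≡∣p∣+∣q∣ p q))

-- Split `r` along `q`: `p` falls into `r ─ q` and `q` into `r ∩ q`.
disjoint⇒∣p∣+∣q∣≤∣r∣ : {p q r : Subset n} → Disjoint p q → p ⊆ r → q ⊆ r →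
                     ∣ p ∣ + ∣ q ∣ ≤ ∣ r ∣
disjoint⇒∣p∣+∣q∣≤∣r∣ {p = p} {q} {r} p#q p⊆r q⊆r = begin
  ∣ p ∣ + ∣ q ∣          ≤⟨ +-mono-≤ (p⊆q⇒∣p∣≤∣q∣ λ x∈p → x∈p∧x∉q⇒x∈p─q (p⊆r x∈p) (p#q x∈p))
                                     (p⊆q⇒∣p∣≤∣q∣ λ x∈q → x∈p∩q⁺ (q⊆r x∈q , x∈q)) ⟩
  ∣ r ─ q ∣ + ∣ r ∩ q ∣  ≡⟨ ∣p─q∣+∣p∩q∣≡∣p∣ r q ⟩
  ∣ r ∣                  ∎
  where open ≤-Reasoning

∈-subsets : (p : Subset n) → p List.∈ subsets n
∈-subsets []            = here refl
∈-subsets (outside ∷ p) = ∈-++⁺ˡ (∈-map⁺ (outside ∷_) (∈-subsets p))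
∈-subsets (inside  ∷ p) = ∈-++⁺ʳ (map (outside ∷_) (subsets _)) (∈-map⁺ (inside ∷_) (∈-subsets p))

-- With its converse below, translates between comparing values of `d` and the relation `_≼_`, so
-- that all counting stays in the naturals.
m-n≤k-l⁺ : ∀ m n k l → m + l ≤ k + n → ℤ.+ m ℤ.- ℤ.+ n ℤ.≤ ℤ.+ k ℤ.- ℤ.+ l
m-n≤k-l⁺ m n k l m+l≤k+n = begin
  ℤ.+ m ℤ.- ℤ.+ n      ≡⟨ ℤ.m-n≡m⊖n m n ⟩
  m ℤ.⊖ n              ≡⟨ ℤ.+-cancelˡ-⊖ l m n ⟨
  (l + m) ℤ.⊖ (l + n)  ≤⟨ ℤ.⊖-monoˡ-≤ (l + n) (subst₂ _≤_ (+-comm m l) (+-comm k n) m+l≤k+n) ⟩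
  (n + k) ℤ.⊖ (l + n)  ≡⟨ cong ((n + k) ℤ.⊖_) (+-comm l n) ⟩
  (n + k) ℤ.⊖ (n + l)  ≡⟨ ℤ.+-cancelˡ-⊖ n k l ⟩
  k ℤ.⊖ l              ≡⟨ ℤ.m-n≡m⊖n k l ⟨
  ℤ.+ k ℤ.- ℤ.+ l      ∎
  where open ℤ.≤-Reasoning

m-n≤k-l⁻ : ∀ m n k l → ℤ.+ m ℤ.- ℤ.+ n ℤ.≤ ℤ.+ k ℤ.- ℤ.+ l → m + l ≤ k + n
m-n≤k-l⁻ m n k l m-n≤k-l = ℤ.drop‿+≤+ (begin
  ℤ.+ m ℤ.+ ℤ.+ l                                ≡⟨ cancel (ℤ.+ m) (ℤ.+ n) (ℤ.+ l) ⟩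
  (ℤ.+ m ℤ.- ℤ.+ n) ℤ.+ (ℤ.+ n ℤ.+ ℤ.+ l)        ≤⟨ ℤ.+-monoˡ-≤ (ℤ.+ n ℤ.+ ℤ.+ l) m-n≤k-l ⟩
  (ℤ.+ k ℤ.- ℤ.+ l) ℤ.+ (ℤ.+ n ℤ.+ ℤ.+ l)        ≡⟨ cong (λ i → (ℤ.+ k ℤ.- ℤ.+ l) ℤ.+ i) (ℤ.+-comm (ℤ.+ n) (ℤ.+ l)) ⟩
  (ℤ.+ k ℤ.- ℤ.+ l) ℤ.+ (ℤ.+ l ℤ.+ ℤ.+ n)        ≡⟨ cancel (ℤ.+ k) (ℤ.+ l) (ℤ.+ n) ⟨
  ℤ.+ k ℤ.+ ℤ.+ n                                ∎)
  where
  open ℤ.≤-Reasoning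
  cancel : ∀ i j k → i ℤ.+ k ≡ (i ℤ.- j) ℤ.+ (j ℤ.+ k)
  cancel = ℤ.solve-∀

-- Neighbourhoods and independence.

module _ (G : Graph n) where
  open Graph G

  infix 4 _≼_

  -- d X ≤ d Y without subtraction.
  _≼_ : Subset n → Subset n → Set
  X ≼ Y = ∣ X ∣ + ∣ N G Y ∣ ≤ ∣ Y ∣ + ∣ N G X ∣

  ∈-N⁺ : ∀ {X u v} → u ∈ X → v ~ u → v ∈ N G X
  ∈-N⁺ {X} {u} {v} u∈X v~u = lookup⇒[]= v _
    (trans (lookup∘tabulate _ v) (dec-true (any? λ u → (u ∈? X) ×-dec (v ~? u)) (u , u∈X , v~u)))

  ∈-N⁻ : ∀ {X v} → v ∈ N G X → ∃ λ u → u ∈ X × v ~ u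
  ∈-N⁻ {X} {v} v∈N with any? (λ u → (u ∈? X) ×-dec (v ~? u))
                      | trans (sym (lookup∘tabulate (λ v → does (any? λ u → (u ∈? X) ×-dec (v ~? u))) v)) ([]=⇒lookup v∈N)
  -- A negative decision would make the entry of `N G X` at `v` equal to `outside`, against `v∈N`.
  ... | yes p | _ = p

  N-mono : ∀ {X Y} → X ⊆ Y → N G X ⊆ N G Y
  N-mono X⊆Y v∈N = let _ , u∈X , v~u = ∈-N⁻ v∈N in ∈-N⁺ (X⊆Y u∈X) v~u

  N-∪ : ∀ X Y → N G (X ∪ Y) ⊆ N G X ∪ N G Y
  N-∪ X Y v∈N with ∈-N⁻ v∈N
  ... | _ , u∈X∪Y , v~u with x∈p∪q⁻ X Y u∈X∪Y
  ...   | inj₁ u∈X = x∈p∪q⁺ (inj₁ (∈-N⁺ u∈X v~u))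
  ...   | inj₂ u∈Y = x∈p∪q⁺ (inj₂ (∈-N⁺ u∈Y v~u))

  independent⇒N-disjoint : ∀ {X} → Independent G X → Disjoint X (N G X)
  independent⇒N-disjoint ind v∈X v∈N = let u , u∈X , v~u = ∈-N⁻ v∈N in ind _ u v∈X u∈X v~u

  independent-⊆ : ∀ {X Y} → X ⊆ Y → Independent G Y → Independent G X
  independent-⊆ X⊆Y ind u v u∈X v∈X = ind u v (X⊆Y u∈X) (X⊆Y v∈X)

  independent-∪ : ∀ {X Y} → Independent G X → Independent G Y → Disjoint Y (N G X) →
                  Independent G (X ∪ Y)
  independent-∪ {X} {Y} indX indY Y#NX u v u∈ v∈ u~v with x∈p∪q⁻ X Y u∈ | x∈p∪q⁻ X Y v∈
  ... | inj₁ u∈X | inj₁ v∈X = indX u v u∈X v∈X u~v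
  ... | inj₁ u∈X | inj₂ v∈Y = Y#NX v∈Y (∈-N⁺ u∈X (~-sym u~v))
  ... | inj₂ u∈Y | inj₁ v∈X = Y#NX u∈Y (∈-N⁺ v∈X u~v)
  ... | inj₂ u∈Y | inj₂ v∈Y = indY u v u∈Y v∈Y u~v

  independent-⊥ : Independent G ⊥
  independent-⊥ u _ u∈⊥ = contradiction u∈⊥ ∉⊥

  -- Critical independent sets.

  critical⇒≼ : ∀ {S} → CriticalIndependent G S → ∀ {T} → Independent G T → T ≼ S
  critical⇒≼ {S} (_ , dS≡) {T} indT = m-n≤k-l⁻ (∣ T ∣) _ (∣ S ∣) _
    (subst (d G T ℤ.≤_) (sym dS≡)
      (All.lookup (xs≤max (d G ⊥) _)
        (∈-map⁺ (d G) (∈-filter⁺ (independent? G) (∈-subsets T) indT))))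

  critical-≼ : ∀ {S T} → CriticalIndependent G S → Independent G T → S ≼ T → CriticalIndependent G T
  critical-≼ {S} {T} crit@(_ , dS≡) indT S≼T = indT , trans
    (ℤ.≤-antisym (m-n≤k-l⁺ (∣ T ∣) _ (∣ S ∣) _ (critical⇒≼ crit indT)) (m-n≤k-l⁺ (∣ S ∣) _ (∣ T ∣) _ S≼T)) dS≡

  -- Without a critical set, membership in `ker` would hold vacuously; `ker⊆core` starts from this
  -- one.
  critical-exists : ∃ (CriticalIndependent G)
  critical-exists with argmax-sel id (d G ⊥) (map (d G) (filter (independent? G) (subsets n)))
  -- The maximum may be reported as the default value, which the empty set attains.
  ... | inj₁ id-c≡d⊥ = ⊥ , independent-⊥ , sym id-c≡d⊥
  ... | inj₂ id-c∈   =
    let S , S∈ , id-c≡dS = ∈-map⁻ (d G) id-c∈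
    in  S , proj₂ (∈-filter⁻ (independent? G) {xs = subsets n} S∈) , sym id-c≡dS

  -- A vertex of `Y` adjacent to some `u` in `X` puts `u` into `N G Y`, so `N G (X ─ N G Y)` misses
  -- `Y`. Both sets counted on the left are thus disjoint parts of `N G X`.
  ∣N[X─NY]∣+∣Y∩NX∣≤∣NX∣ : ∀ X Y → ∣ N G (X ─ N G Y) ∣ + ∣ Y ∩ N G X ∣ ≤ ∣ N G X ∣
  ∣N[X─NY]∣+∣Y∩NX∣≤∣NX∣ X Y = disjoint⇒∣p∣+∣q∣≤∣r∣
    (λ v∈N v∈Y∩NX → let u , u∈X─NY , v~u = ∈-N⁻ v∈N in
      x∈p─q⇒x∉q X (N G Y) u∈X─NY (∈-N⁺ (proj₁ (x∈p∩q⁻ Y _ v∈Y∩NX)) (~-sym v~u)))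
    (N-mono (p─q⊆p X (N G Y)))
    (p∩q⊆q Y (N G X))

  -- The compensation is crosswise: the vertices `X ∩ N G Y` lost by `X` are paid for by the drop
  -- from `N G Y` to `N G (Y ─ N G X)`, and symmetrically. Hence the bound concerns the sum.
  uncrossing : ∀ X Y →
    (∣ X ∣ + ∣ Y ∣) + (∣ N G (X ─ N G Y) ∣ + ∣ N G (Y ─ N G X) ∣) ≤
    (∣ X ─ N G Y ∣ + ∣ Y ─ N G X ∣) + (∣ N G X ∣ + ∣ N G Y ∣)
  uncrossing X Y = begin
    (∣ X ∣ + ∣ Y ∣) + (nX′ + nY′)                              ≡⟨ cong₂ (λ x y → (x + y) + (nX′ + nY′)) (∣p─q∣+∣p∩q∣≡∣p∣ X (N G Y)) (∣p─q∣+∣p∩q∣≡∣p∣ Y (N G X)) ⟨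
    ((X′ + X∩NY) + (Y′ + Y∩NX)) + (nX′ + nY′)                  ≡⟨ rearrange X′ X∩NY Y′ Y∩NX nX′ nY′ ⟩
    (X′ + Y′) + ((nX′ + Y∩NX) + (nY′ + X∩NY))                  ≤⟨ +-monoʳ-≤ (X′ + Y′) (+-mono-≤ (∣N[X─NY]∣+∣Y∩NX∣≤∣NX∣ X Y) (∣N[X─NY]∣+∣Y∩NX∣≤∣NX∣ Y X)) ⟩
    (X′ + Y′) + (∣ N G X ∣ + ∣ N G Y ∣)                        ∎
    where
    open ≤-Reasoning
    X′ Y′ X∩NY Y∩NX nX′ nY′ : ℕ
    X′   = ∣ X ─ N G Y ∣
    Y′   = ∣ Y ─ N G X ∣
    X∩NY = ∣ X ∩ N G Y ∣
    Y∩NX = ∣ Y ∩ N G X ∣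
    nX′  = ∣ N G (X ─ N G Y) ∣
    nY′  = ∣ N G (Y ─ N G X) ∣
    rearrange : ∀ a b c d e f → ((a + b) + (c + d)) + (e + f) ≡ (a + c) + ((e + d) + (f + b))
    rearrange = solve-∀

  -- The kernel lies in the core.

  critical-∩-maximum : ∀ {S M} → CriticalIndependent G S → MaximumIndependent G M →
                       CriticalIndependent G (S ∩ M)
  critical-∩-maximum {S} {M} crit@(indS , _) (indM , max) =
    critical-≼ crit (independent-⊆ (p∩q⊆p S M) indS) S≼S∩M
    where
    open ≤-Reasoning
    M′ : Subset n
    M′ = M ─ N G S

    -- An exchange in `M`: trading `M ∩ N G S` for the vertices of `S` outside `M` gives `S ∪ M′`,
    -- which is independent and so no larger than `M`.
    ∣S∣≤ : ∣ S ∣ ≤ ∣ S ∩ M ∣ + ∣ M ∩ N G S ∣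
    ∣S∣≤ = +-cancelʳ-≤ (∣ M′ ∣) _ _ (begin
      ∣ S ∣ + ∣ M′ ∣                                 ≡⟨ ∣p∪q∣+∣p∩q∣≡∣p∣+∣q∣ S M′ ⟨
      ∣ S ∪ M′ ∣ + ∣ S ∩ M′ ∣                        ≤⟨ +-mono-≤
        (max (S ∪ M′) (independent-∪ indS (independent-⊆ (p─q⊆p M _) indM) (x∈p─q⇒x∉q M _)))
        (p⊆q⇒∣p∣≤∣q∣ λ v∈ → let v∈S , v∈M′ = x∈p∩q⁻ S M′ v∈ in x∈p∩q⁺ (v∈S , p─q⊆p M _ v∈M′)) ⟩
      ∣ M ∣ + ∣ S ∩ M ∣                              ≡⟨ cong (_+ ∣ S ∩ M ∣) (∣p─q∣+∣p∩q∣≡∣p∣ M (N G S)) ⟨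
      (∣ M′ ∣ + ∣ M ∩ N G S ∣) + ∣ S ∩ M ∣           ≡⟨ rearrange (∣ M′ ∣) (∣ M ∩ N G S ∣) (∣ S ∩ M ∣) ⟩
      (∣ S ∩ M ∣ + ∣ M ∩ N G S ∣) + ∣ M′ ∣           ∎)
      where
      rearrange : ∀ a b c → (a + b) + c ≡ (c + b) + a
      rearrange = solve-∀

    S∩M⊆S─NM : S ∩ M ⊆ S ─ N G M
    S∩M⊆S─NM v∈ = let v∈S , v∈M = x∈p∩q⁻ S M v∈ in
      x∈p∧x∉q⇒x∈p─q v∈S (independent⇒N-disjoint indM v∈M)

    -- Passing from `S` to `S ∩ M` costs at most `∣ M ∩ N G S ∣` vertices, while the neighbourhood
    -- shrinks by at least as many, because `S ∩ M` lies in `S ─ N G M`.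
    S≼S∩M : S ≼ S ∩ M
    S≼S∩M = begin
      ∣ S ∣ + ∣ N G (S ∩ M) ∣                                  ≤⟨ +-mono-≤ ∣S∣≤ (p⊆q⇒∣p∣≤∣q∣ (N-mono S∩M⊆S─NM)) ⟩
      (∣ S ∩ M ∣ + ∣ M ∩ N G S ∣) + ∣ N G (S ─ N G M) ∣        ≡⟨ rearrange (∣ S ∩ M ∣) _ _ ⟩
      ∣ S ∩ M ∣ + (∣ N G (S ─ N G M) ∣ + ∣ M ∩ N G S ∣)        ≤⟨ +-monoʳ-≤ (∣ S ∩ M ∣) (∣N[X─NY]∣+∣Y∩NX∣≤∣NX∣ S M) ⟩
      ∣ S ∩ M ∣ + ∣ N G S ∣                                    ∎
      where
      rearrange : ∀ a b c → (a + b) + c ≡ a + (c + b)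
      rearrange = solve-∀

  ker⊆core : ∀ {v} → ker G v → core G v
  ker⊆core v∈ker M maxM =
    let S , crit = critical-exists
    in  p∩q⊆q S M (v∈ker (S ∩ M) (critical-∩-maximum crit maxM))

  -- Makes results about `A` available for `B`. The bipartition is abstracted afresh in each module
  -- below so that earlier lemmas can be applied to the swapped one.
  isBipartition-swap : ∀ {A B} → IsBipartition G A B → IsBipartition G B A
  isBipartition-swap {A} {B} bip = record
    { A-nonempty    = B-nonempty
    ; B-nonempty    = A-nonempty
    ; disjoint      = trans (∩-comm B A) disjoint
    ; covering      = trans (∪-comm B A) covering
    ; A-independent = B-independent
    ; B-independent = A-independent
    }
    where open IsBipartition bip

  -- Splitting sets along the bipartition.

  module _ {A B} (bip : IsBipartition G A B) where
    open IsBipartition bip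

    A#B : Disjoint A B
    A#B v∈A v∈B = ∉⊥ (subst (_ ∈_) disjoint (x∈p∩q⁺ (v∈A , v∈B)))

    ∈A⊎∈B : ∀ v → v ∈ A ⊎ v ∈ B
    ∈A⊎∈B v = x∈p∪q⁻ A B (subst (v ∈_) (sym covering) ∈⊤)

    N⊆B : ∀ {X} → X ⊆ A → N G X ⊆ B
    N⊆B X⊆A {v} v∈N with ∈A⊎∈B v
    ... | inj₁ v∈A = let u , u∈X , v~u = ∈-N⁻ v∈N in contradiction v~u (A-independent v u v∈A (X⊆A u∈X))
    ... | inj₂ v∈B = v∈B

    ⊆∩A∪∩B : ∀ S → S ⊆ (S ∩ A) ∪ (S ∩ B)
    ⊆∩A∪∩B S {v} v∈S with ∈A⊎∈B v
    ... | inj₁ v∈A = x∈p∪q⁺ (inj₁ (x∈p∩q⁺ (v∈S , v∈A)))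
    ... | inj₂ v∈B = x∈p∪q⁺ (inj₂ (x∈p∩q⁺ (v∈S , v∈B)))

    ∣S∣≤∣S∩A∣+∣S∩B∣ : ∀ S → ∣ S ∣ ≤ ∣ S ∩ A ∣ + ∣ S ∩ B ∣
    ∣S∣≤∣S∩A∣+∣S∩B∣ S = ≤-trans (p⊆q⇒∣p∣≤∣q∣ (⊆∩A∪∩B S)) (∣p∪q∣≤∣p∣+∣q∣ (S ∩ A) (S ∩ B))

  module _ {A B} (bip : IsBipartition G A B) where
    open IsBipartition bip

    -- The two neighbourhoods lie on opposite sides, hence are disjoint.
    ∣N[S∩A]∣+∣N[S∩B]∣≤∣NS∣ : ∀ S → ∣ N G (S ∩ A) ∣ + ∣ N G (S ∩ B) ∣ ≤ ∣ N G S ∣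
    ∣N[S∩A]∣+∣N[S∩B]∣≤∣NS∣ S = disjoint⇒∣p∣+∣q∣≤∣r∣
      (λ v∈ v∈′ → A#B bip (N⊆B (isBipartition-swap bip) (p∩q⊆q S B) v∈′) (N⊆B bip (p∩q⊆q S A) v∈))
      (N-mono (p∩q⊆p S A)) (N-mono (p∩q⊆p S B))

    -- X ∪ (S ∩ B) competes with S, and the contributions of S ∩ B cancel.
    critical-exchange : ∀ {S X} → CriticalIndependent G S → X ⊆ A → Disjoint X (N G (S ∩ B)) →
                        X ≼ S ∩ A
    critical-exchange {S} {X} crit@(indS , _) X⊆A X#N =
      +-cancelʳ-≤ (∣ Y ∣ + ∣ N G Y ∣) _ _ (begin
        (∣ X ∣ + ∣ N G (S ∩ A) ∣) + (∣ Y ∣ + ∣ N G Y ∣)    ≡⟨ swap (∣ X ∣) _ _ _ ⟩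
        (∣ X ∣ + ∣ Y ∣) + (∣ N G (S ∩ A) ∣ + ∣ N G Y ∣)    ≤⟨ +-mono-≤ ∣X∣+∣Y∣≤ (∣N[S∩A]∣+∣N[S∩B]∣≤∣NS∣ S) ⟩
        ∣ Y ∪ X ∣ + ∣ N G S ∣                              ≤⟨ critical⇒≼ crit indY∪X ⟩
        ∣ S ∣ + ∣ N G (Y ∪ X) ∣                            ≤⟨ +-mono-≤ (∣S∣≤∣S∩A∣+∣S∩B∣ bip S)
                                                              (≤-trans (p⊆q⇒∣p∣≤∣q∣ (N-∪ Y X)) (∣p∪q∣≤∣p∣+∣q∣ (N G Y) (N G X))) ⟩
        (∣ S ∩ A ∣ + ∣ Y ∣) + (∣ N G Y ∣ + ∣ N G X ∣)      ≡⟨ swap′ (∣ S ∩ A ∣) _ _ _ ⟩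
        (∣ S ∩ A ∣ + ∣ N G X ∣) + (∣ Y ∣ + ∣ N G Y ∣)      ∎)
      where
      open ≤-Reasoning
      Y : Subset n
      Y = S ∩ B
      indY∪X : Independent G (Y ∪ X)
      indY∪X = independent-∪ (independent-⊆ (p∩q⊆p S B) indS) (independent-⊆ X⊆A A-independent) X#N
      ∣X∣+∣Y∣≤ : ∣ X ∣ + ∣ Y ∣ ≤ ∣ Y ∪ X ∣
      ∣X∣+∣Y∣≤ = disjoint⇒∣p∣+∣q∣≤∣r∣ (λ v∈X v∈Y → A#B bip (X⊆A v∈X) (p∩q⊆q S B v∈Y))
        (q⊆p∪q Y X) (p⊆p∪q X)
      swap : ∀ a b c d → (a + b) + (c + d) ≡ (a + c) + (b + d)
      swap = solve-∀
      swap′ : ∀ a b c d → (a + b) + (c + d) ≡ (a + d) + (b + c)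
      swap′ = solve-∀

  -- Maximising `d` on one side; the core lies in the kernel.

  module _ {A B} (bip : IsBipartition G A B) where
    open IsBipartition bip

    -- `critical-exchange` needs a set avoiding `N G (S ∩ B)`, and uncrossing supplies one: in terms
    -- of `d`, `d X + d Y ≤ d X′ + d Y′ ≤ d (S ∩ A) + d Y`.
    critical-∩-maximises : ∀ {S X} → CriticalIndependent G S → X ⊆ A → X ≼ S ∩ A
    critical-∩-maximises {S} {X} crit X⊆A =
      -- The cancelled summand collects the sizes that occur on both sides once the three
      -- inequalities are added.
      +-cancelʳ-≤ ((∣ Y ∣ + ∣ N G Y ∣) + ((∣ X′ ∣ + ∣ N G X′ ∣) + (∣ Y′ ∣ + ∣ N G Y′ ∣))) _ _
        (subst₂ _≤_
          (lhs (∣ X ∣) (∣ Y ∣) (∣ N G X′ ∣) (∣ N G Y′ ∣) (∣ X′ ∣) (∣ N G (S ∩ A) ∣) (∣ Y′ ∣) (∣ N G Y ∣))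
          (rhs (∣ X′ ∣) (∣ Y′ ∣) (∣ N G X ∣) (∣ N G Y ∣) (∣ S ∩ A ∣) (∣ N G X′ ∣) (∣ Y ∣) (∣ N G Y′ ∣))
          (+-mono-≤ (uncrossing X Y) (+-mono-≤ X′≼S∩A Y′≼Y)))
      where
      Y X′ Y′ : Subset n
      Y  = S ∩ B
      X′ = X ─ N G Y
      Y′ = Y ─ N G X
      X′≼S∩A : X′ ≼ S ∩ A
      X′≼S∩A = critical-exchange bip crit (X⊆A ∘ p─q⊆p X _) (x∈p─q⇒x∉q X _)
      -- The exchange with the sides swapped: `Y′` lies in the independent set `S`, so it avoids
      -- `N G (S ∩ A)`.
      Y′≼Y : Y′ ≼ Y
      Y′≼Y = critical-exchange (isBipartition-swap bip) crit (p∩q⊆q S B ∘ p─q⊆p Y _)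
        (λ v∈Y′ v∈N → independent⇒N-disjoint (proj₁ crit) (p∩q⊆p S B (p─q⊆p Y _ v∈Y′))
          (N-mono (p∩q⊆p S A) v∈N))
      lhs : ∀ x y nx′ ny′ x′ na y′ ny →
            ((x + y) + (nx′ + ny′)) + ((x′ + na) + (y′ + ny)) ≡
            (x + na) + ((y + ny) + ((x′ + nx′) + (y′ + ny′)))
      lhs = solve-∀
      rhs : ∀ x′ y′ nx ny a nx′ y ny′ →
            ((x′ + y′) + (nx + ny)) + ((a + nx′) + (y + ny′)) ≡
            (a + nx) + ((y + ny) + ((x′ + nx′) + (y′ + ny′)))
      rhs = solve-∀

    -- For `X ⊆ A` its size is `∣ B ∣ + d X`, so a larger `d` on subsets of `A` means a larger
    -- independent set.
    completion : Subset n → Subset n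
    completion X = X ∪ (B ─ N G X)

    completion-maximum : ∀ {S} → CriticalIndependent G S → MaximumIndependent G (completion (S ∩ A))
    completion-maximum {S} crit@(indS , _) =
      independent-∪ (independent-⊆ (p∩q⊆p S A) indS) (independent-⊆ (p─q⊆p B _) B-independent) (x∈p─q⇒x∉q B _) ,
      -- Adding both neighbourhood sizes clears the subtractions from
      -- `∣ T ∣ ≤ ∣ B ∣ + d (T ∩ A) ≤ ∣ B ∣ + d X`.
      λ T indT → +-cancelʳ-≤ (∣ N G X ∣ + ∣ N G (T ∩ A) ∣) _ _ (begin
        ∣ T ∣ + (∣ N G X ∣ + ∣ N G (T ∩ A) ∣)                    ≤⟨ +-monoˡ-≤ _ (∣S∣≤∣S∩A∣+∣S∩B∣ bip T) ⟩
        (∣ T ∩ A ∣ + ∣ T ∩ B ∣) + (∣ N G X ∣ + ∣ N G (T ∩ A) ∣)  ≡⟨ swap (∣ T ∩ A ∣) _ _ _ ⟩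
        (∣ T ∩ A ∣ + ∣ N G X ∣) + (∣ T ∩ B ∣ + ∣ N G (T ∩ A) ∣)  ≤⟨ +-mono-≤ (critical-∩-maximises crit (p∩q⊆q T A)) (T∩B-bound T indT) ⟩
        (∣ X ∣ + ∣ N G (T ∩ A) ∣) + ∣ B ∣                        ≤⟨ +-monoʳ-≤ _ ∣B∣≤ ⟩
        (∣ X ∣ + ∣ N G (T ∩ A) ∣) + (∣ B ─ N G X ∣ + ∣ N G X ∣)  ≡⟨ swap′ (∣ X ∣) _ _ _ ⟩
        (∣ X ∣ + ∣ B ─ N G X ∣) + (∣ N G X ∣ + ∣ N G (T ∩ A) ∣)  ≤⟨ +-monoˡ-≤ _ ∣X∣+∣B─NX∣≤ ⟩
        ∣ completion X ∣ + (∣ N G X ∣ + ∣ N G (T ∩ A) ∣)         ∎)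
      where
      open ≤-Reasoning
      X : Subset n
      X = S ∩ A
      T∩B-bound : ∀ T → Independent G T → ∣ T ∩ B ∣ + ∣ N G (T ∩ A) ∣ ≤ ∣ B ∣
      T∩B-bound T indT = disjoint⇒∣p∣+∣q∣≤∣r∣
        (λ v∈ v∈N → independent⇒N-disjoint indT (p∩q⊆p T B v∈) (N-mono (p∩q⊆p T A) v∈N))
        (p∩q⊆q T B) (N⊆B bip (p∩q⊆q T A))
      ∣B∣≤ : ∣ B ∣ ≤ ∣ B ─ N G X ∣ + ∣ N G X ∣
      ∣B∣≤ = ≤-trans (≤-reflexive (sym (∣p─q∣+∣p∩q∣≡∣p∣ B (N G X)))) (+-monoʳ-≤ _ (∣p∩q∣≤∣q∣ B (N G X)))
      ∣X∣+∣B─NX∣≤ : ∣ X ∣ + ∣ B ─ N G X ∣ ≤ ∣ completion X ∣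
      ∣X∣+∣B─NX∣≤ = disjoint⇒∣p∣+∣q∣≤∣r∣
        (λ v∈X v∈B─ → A#B bip (p∩q⊆q S A v∈X) (p─q⊆p B _ v∈B─))
        (p⊆p∪q _) (q⊆p∪q X _)
      swap : ∀ a b c d → (a + b) + (c + d) ≡ (a + c) + (b + d)
      swap = solve-∀
      swap′ : ∀ a b c d → (a + b) + (c + d) ≡ (a + c) + (d + b)
      swap′ = solve-∀

    -- The completion of `S ∩ A` adds only vertices of `B`, so a core vertex in `A` must come from
    -- `S` itself.
    core∩A⊆ker : ∀ {v} → v ∈ A → core G v → ker G v
    core∩A⊆ker v∈A v∈core S crit with x∈p∪q⁻ (S ∩ A) _ (v∈core _ (completion-maximum crit))
    ... | inj₁ v∈S∩A = p∩q⊆p S A v∈S∩A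
    ... | inj₂ v∈B─  = contradiction (p─q⊆p B _ v∈B─) (A#B bip v∈A)

theorem3p3 : (n : ℕ) (G : Graph n) → Bipartite G → ker G ≐ core G
theorem3p3 n G (A , B , bip) = ker⊆core G , core⊆ker
  where
  core⊆ker : ∀ {v} → core G v → ker G v
  core⊆ker {v} with ∈A⊎∈B G bip v
  ... | inj₁ v∈A = core∩A⊆ker G bip v∈A
  ... | inj₂ v∈B = core∩A⊆ker G (isBipartition-swap G bip) v∈B
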